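{- If $n$ is a positive integer and $p$ is an integer, then $$\sum_{k=0}^n(-1)^{(p-1)(n-k)}\frac{n}{n+k}\binom{n+k}{n-k}L_p^{2k}=\frac{L_{2pn}}{2},$$ $$\sum_{k=0}^n(-1)^{p(n-k)}\frac{n}{n+k}\binom{n+k}{n-k}5^kF_p^{2k}=\frac{L_{2pn}}{2}.$$
   Context: $F_n$ and $L_n$ ($n\in\mathbb{Z}$) are the Fibonacci and Lucas numbers: $F_0=0$, $F_1=1$, $F_n=F_{n-1}+F_{n-2}$; $L_0=2$, $L_1=1$, $L_n=L_{n-1}+L_{n-2}$, extended to negative indices by $F_{ -n}=(-1)^{n-1}F_n$, $L_{ -n}=(-1)^nL_n$. The convention $0^0=1$ is used. -}

module Defs where

open import Data.Integer.Base as ℤ using (ℤ; +_; -[1+_]; -1ℤ)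
open import Data.Nat.Base as ℕ using (ℕ; zero; suc)
open import Data.Rational.Base as ℚ using (ℚ; 1/_; +-*-rawSemiring)

-- q ^ 0 is 1ℚ for every q, including 0ℚ.
open import Algebra.Definitions.RawSemiring +-*-rawSemiring public using (_^_)

infixr 8 _^ᶻ_

_^ᶻ_ : (q : ℚ) .{{_ : ℚ.NonZero q}} → ℤ → ℚ
q ^ᶻ (+ n)    = q ^ n
q ^ᶻ -[1+ n ] = (1/ q) ^ suc n

fib : ℕ → ℕ
fib zero          = 0
fib (suc zero)    = 1
fib (suc (suc n)) = fib (suc n) ℕ.+ fib n

lucas : ℕ → ℕ
lucas zero          = 2
lucas (suc zero)    = 1
lucas (suc (suc n)) = lucas (suc n) ℕ.+ lucas n

-- Since -[1+ n ] is -(n + 1), the sign (-1)^(m-1) of F₋ₘ is (-1)^n here,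
-- while the sign (-1)^m of L₋ₘ is (-1)^(n+1).
F : ℤ → ℤ
F (+ n)    = + fib n
F -[1+ n ] = -1ℤ ℤ.^ n ℤ.* + fib (suc n)

L : ℤ → ℤ
L (+ n)    = + lucas n
L -[1+ n ] = -1ℤ ℤ.^ suc n ℤ.* + lucas (suc n)

+-nonZeroˡ : ∀ m n .{{_ : ℕ.NonZero m}} → ℕ.NonZero (m ℕ.+ n)
+-nonZeroˡ (suc m) n = _

{-# OPTIONS --safe #-}

-- With s = ±1, expand V₂ₙ(y) = Σₖ 2n/(n+k) C(n+k,n-k) sⁿ⁻ᵏ yᵏ through
-- 2n/(n+k) C(n+k,n-k) = C(n+k,2k) + C(n-1+k,2k), so that V₂ₙ = Bₙ + s Bₙ₋₁ for
-- Bₙ = Σₖ C(n+k,2k) sⁿ⁻ᵏ yᵏ.  Pascal's rule, applied to Bₙ together with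
-- Dₙ = Σₖ C(n+1+k,2k+1) sⁿ⁻ᵏ yᵏ, gives Bₙ₊₂ = (y + 2s) Bₙ₊₁ - Bₙ.  Both choices
-- (y, s) = (Lₚ², -(-1)ᵖ) and (5Fₚ², (-1)ᵖ) satisfy y + 2s = L₂ₚ, and L₂ₚₙ obeys the
-- same recurrence in n with the same initial values.
module Submission where

open import Defs
open import Algebra.Bundles using (CommutativeRing)
open import Data.Fin.Base using (Fin; toℕ)
open import Data.Fin.Properties using (toℕ≤pred[n])
open import Data.Integer.Base as ℤ using (ℤ; +_; -[1+_]; -1ℤ; 0ℤ; 1ℤ; ∣_∣)
import Data.Integer.Properties as ℤ
open import Data.Integer.Tactic.RingSolver using (solve-∀)
open import Data.Nat.Base as ℕ using (ℕ; zero; suc; _∸_; _≤_; s≤s; z≤n)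
open import Data.Nat.Combinatorics using (_C_; nCk≡nC[n∸k]; nCn≡1; nC1≡n; k>n⇒nCk≡0; nCk+nC[k+1]≡[n+1]C[k+1])
import Data.Nat.Properties as ℕ
import Data.Nat.Tactic.RingSolver as ℕ
open import Data.Product.Base using (_×_; _,_)
open import Function.Base using (_∘_)
open import Relation.Binary.PropositionalEquality.Core
open import Relation.Binary.PropositionalEquality using (module ≡-Reasoning; _≗_)
open ≡-Reasoning

-- Binomial coefficients

nC0≡1 : ∀ n → n C 0 ≡ 1
nC0≡1 n = trans (nCk≡nC[n∸k] {0} {n} z≤n) (nCn≡1 n)

-- The absorption identity, by induction through Pascal's rule: the copy of `a` that `split` leaves
-- over raises the factor `suc n` to `suc (suc n)`.
[1+k]*[1+n]C[1+k]≡[1+n]*nCk : ∀ n k → suc k ℕ.* (suc n C suc k) ≡ suc n ℕ.* (n C k)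
[1+k]*[1+n]C[1+k]≡[1+n]*nCk n zero = begin
  1 ℕ.* (suc n C 1)    ≡⟨ ℕ.*-identityˡ _ ⟩
  suc n C 1            ≡⟨ nC1≡n (suc n) ⟩
  suc n                ≡⟨ ℕ.*-identityʳ (suc n) ⟨
  suc n ℕ.* 1          ≡⟨ cong (suc n ℕ.*_) (nC0≡1 n) ⟨
  suc n ℕ.* (n C 0)    ∎
[1+k]*[1+n]C[1+k]≡[1+n]*nCk zero (suc k) = begin
  suc (suc k) ℕ.* (1 C suc (suc k)) ≡⟨ cong (suc (suc k) ℕ.*_) (k>n⇒nCk≡0 (s≤s (s≤s (z≤n {k})))) ⟩
  suc (suc k) ℕ.* 0                 ≡⟨ ℕ.*-zeroʳ (suc (suc k)) ⟩
  0                                 ≡⟨ cong (1 ℕ.*_) (k>n⇒nCk≡0 (s≤s (z≤n {k}))) ⟨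
  1 ℕ.* (0 C suc k)                 ∎
[1+k]*[1+n]C[1+k]≡[1+n]*nCk (suc n) (suc k) = begin
  suc (suc k) ℕ.* (suc (suc n) C suc (suc k))
    ≡⟨ cong (suc (suc k) ℕ.*_) (nCk+nC[k+1]≡[n+1]C[k+1] (suc n) (suc k)) ⟨
  suc (suc k) ℕ.* (a ℕ.+ b)
    ≡⟨ split k a b ⟩
  (suc k ℕ.* a ℕ.+ suc (suc k) ℕ.* b) ℕ.+ a
    ≡⟨ cong (ℕ._+ a) (cong₂ ℕ._+_ ([1+k]*[1+n]C[1+k]≡[1+n]*nCk n k) ([1+k]*[1+n]C[1+k]≡[1+n]*nCk n (suc k))) ⟩
  (suc n ℕ.* (n C k) ℕ.+ suc n ℕ.* (n C suc k)) ℕ.+ a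
    ≡⟨ cong (ℕ._+ a) (ℕ.*-distribˡ-+ (suc n) (n C k) (n C suc k)) ⟨
  suc n ℕ.* (n C k ℕ.+ n C suc k) ℕ.+ a
    ≡⟨ cong (λ z → suc n ℕ.* z ℕ.+ a) (nCk+nC[k+1]≡[n+1]C[k+1] n k) ⟩
  suc n ℕ.* a ℕ.+ a
    ≡⟨ ℕ.+-comm _ a ⟩
  suc (suc n) ℕ.* a ∎
  where
  a = suc n C suc k
  b = suc n C suc (suc k)
  split : ∀ k a b → suc (suc k) ℕ.* (a ℕ.+ b) ≡ (suc k ℕ.* a ℕ.+ suc (suc k) ℕ.* b) ℕ.+ a
  split = ℕ.solve-∀

[k+d]Ck≡[k+d]Cd : ∀ k d → (k ℕ.+ d) C k ≡ (k ℕ.+ d) C d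
[k+d]Ck≡[k+d]Cd k d = trans (nCk≡nC[n∸k] (ℕ.m≤m+n k d)) (cong ((k ℕ.+ d) C_) (ℕ.m+n∸m≡n k d))

-- Absorption seen from the complementary index: reflect the binomial, absorb, reflect back.
[1+d]*[k+1+d]Ck≡[k+1+d]*[k+d]Ck : ∀ k d → suc d ℕ.* ((k ℕ.+ suc d) C k) ≡ (k ℕ.+ suc d) ℕ.* ((k ℕ.+ d) C k)
[1+d]*[k+1+d]Ck≡[k+1+d]*[k+d]Ck k d = begin
  suc d ℕ.* ((k ℕ.+ suc d) C k)       ≡⟨ cong (suc d ℕ.*_) ([k+d]Ck≡[k+d]Cd k (suc d)) ⟩
  suc d ℕ.* ((k ℕ.+ suc d) C suc d)   ≡⟨ cong (λ z → suc d ℕ.* (z C suc d)) (ℕ.+-suc k d) ⟩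
  suc d ℕ.* (suc (k ℕ.+ d) C suc d)   ≡⟨ [1+k]*[1+n]C[1+k]≡[1+n]*nCk (k ℕ.+ d) d ⟩
  suc (k ℕ.+ d) ℕ.* ((k ℕ.+ d) C d)   ≡⟨ cong₂ ℕ._*_ (ℕ.+-suc k d) ([k+d]Ck≡[k+d]Cd k d) ⟨
  (k ℕ.+ suc d) ℕ.* ((k ℕ.+ d) C k)   ∎

-- This is the coefficient of `B n` one place past its top index; its vanishing lets `eval-extend`
-- lengthen the sum.
[n+1+n]C[2+2n]≡0 : ∀ n → (n ℕ.+ suc n) C (2 ℕ.* suc n) ≡ 0
[n+1+n]C[2+2n]≡0 n = k>n⇒nCk≡0 (ℕ.≤-reflexive (lem n))
  where
  lem : ∀ n → suc (n ℕ.+ suc n) ≡ 2 ℕ.* suc n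
  lem = ℕ.solve-∀

-- The integer 2n/(n+k) · C(n+k,n-k), where n = suc m.
coeff : ℕ → ℕ → ℕ
coeff m k = (suc m ℕ.+ k) C (2 ℕ.* k) ℕ.+ (m ℕ.+ k) C (2 ℕ.* k)

-- Stated without division. If n - k = d + 1 and K = 2k, then n + k = K + d + 1 and 2n = (n + k) +
-- (d + 1). The first part of 2n yields the first binomial of `coeff`; the second yields the other
-- one by absorption.
2n*[n+k]C[n-k]≡coeff : ∀ m k → k ≤ suc m →
  2 ℕ.* suc m ℕ.* ((suc m ℕ.+ k) C (suc m ∸ k)) ≡ (suc m ℕ.+ k) ℕ.* coeff m k
2n*[n+k]C[n-k]≡coeff m k k≤n with suc m ∸ k in eq
-- Here n = k, so the binomials of `coeff` are C(2k,2k) = 1 and C(2k-1,2k) = 0.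
... | zero = begin
  2 ℕ.* n ℕ.* ((n ℕ.+ k) C 0)   ≡⟨ cong (2 ℕ.* n ℕ.*_) (nC0≡1 (n ℕ.+ k)) ⟩
  2 ℕ.* n ℕ.* 1                 ≡⟨ lem n ⟩
  (n ℕ.+ n) ℕ.* (1 ℕ.+ 0)       ≡⟨ cong (λ z → (n ℕ.+ z) ℕ.* (1 ℕ.+ 0)) n≡k ⟩
  (n ℕ.+ k) ℕ.* (1 ℕ.+ 0)       ≡⟨ cong ((n ℕ.+ k) ℕ.*_) (cong₂ ℕ._+_ e₁ e₂) ⟨
  (n ℕ.+ k) ℕ.* coeff m k       ∎
  where
  n = suc m
  n≡k : n ≡ k
  n≡k = ℕ.≤-antisym (ℕ.m∸n≡0⇒m≤n eq) k≤n
  e₁ : (n ℕ.+ k) C (2 ℕ.* k) ≡ 1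
  e₁ rewrite sym n≡k | ℕ.+-identityʳ m = nCn≡1 (n ℕ.+ n)
  e₂ : (m ℕ.+ k) C (2 ℕ.* k) ≡ 0
  e₂ rewrite sym n≡k | ℕ.+-identityʳ m = k>n⇒nCk≡0 (ℕ.n<1+n (m ℕ.+ n))
  lem : ∀ n → 2 ℕ.* n ℕ.* 1 ≡ (n ℕ.+ n) ℕ.* (1 ℕ.+ 0)
  lem = ℕ.solve-∀
... | suc d = begin
  2 ℕ.* n ℕ.* (N C suc d)                     ≡⟨ cong (λ z → 2 ℕ.* n ℕ.* (z C suc d)) N≡ ⟩
  2 ℕ.* n ℕ.* ((K ℕ.+ suc d) C suc d)         ≡⟨ cong (2 ℕ.* n ℕ.*_) ([k+d]Ck≡[k+d]Cd K (suc d)) ⟨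
  2 ℕ.* n ℕ.* X                               ≡⟨ cong (ℕ._* X) 2n≡ ⟩
  ((K ℕ.+ suc d) ℕ.+ suc d) ℕ.* X             ≡⟨ ℕ.*-distribʳ-+ X (K ℕ.+ suc d) (suc d) ⟩
  (K ℕ.+ suc d) ℕ.* X ℕ.+ suc d ℕ.* X         ≡⟨ cong ((K ℕ.+ suc d) ℕ.* X ℕ.+_) ([1+d]*[k+1+d]Ck≡[k+1+d]*[k+d]Ck K d) ⟩
  (K ℕ.+ suc d) ℕ.* X ℕ.+ (K ℕ.+ suc d) ℕ.* Y ≡⟨ ℕ.*-distribˡ-+ (K ℕ.+ suc d) X Y ⟨
  (K ℕ.+ suc d) ℕ.* (X ℕ.+ Y)                 ≡⟨ cong₂ (λ u v → u ℕ.* (u C K ℕ.+ v C K)) N≡ M≡ ⟨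
  N ℕ.* coeff m k                             ∎
  where
  n = suc m
  N = n ℕ.+ k
  K = 2 ℕ.* k
  X = (K ℕ.+ suc d) C K
  Y = (K ℕ.+ d) C K
  n≡ : n ≡ k ℕ.+ suc d
  n≡ = trans (sym (ℕ.m+[n∸m]≡n k≤n)) (cong (k ℕ.+_) eq)
  N≡ : N ≡ K ℕ.+ suc d
  N≡ = trans (cong (ℕ._+ k) n≡) (lem k (suc d))
    where lem : ∀ k d → k ℕ.+ d ℕ.+ k ≡ 2 ℕ.* k ℕ.+ d
          lem = ℕ.solve-∀
  M≡ : m ℕ.+ k ≡ K ℕ.+ d
  M≡ = ℕ.suc-injective (trans N≡ (ℕ.+-suc K d))
  2n≡ : 2 ℕ.* n ≡ K ℕ.+ suc d ℕ.+ suc d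
  2n≡ = trans (cong (2 ℕ.*_) n≡) (lem k (suc d))
    where lem : ∀ k d → 2 ℕ.* (k ℕ.+ d) ≡ 2 ℕ.* k ℕ.+ d ℕ.+ d
          lem = ℕ.solve-∀

-- The homogeneous sums B and D

module HomogeneousSum (s y : ℤ) where

  open import Data.Integer.Base using (_+_; _*_; -_)

  -- eval c n = Σₖ c k · sⁿ⁻ᵏ · yᵏ over k ≤ n.
  eval : (ℕ → ℤ) → ℕ → ℤ
  eval c zero    = c 0
  eval c (suc n) = s ℤ.^ suc n * c 0 + y * eval (c ∘ suc) n

  eval-cong : ∀ {c c′} → c ≗ c′ → ∀ n → eval c n ≡ eval c′ n
  eval-cong eq zero    = eq 0
  eval-cong eq (suc n) =
    cong₂ (λ u v → s ℤ.^ suc n * u + y * v) (eq 0) (eval-cong (eq ∘ suc) n)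

  eval-+ : ∀ c c′ n → eval (λ k → c k + c′ k) n ≡ eval c n + eval c′ n
  eval-+ c c′ zero    = refl
  eval-+ c c′ (suc n) =
    trans (cong (λ u → s ℤ.^ suc n * (c 0 + c′ 0) + y * u) (eval-+ (c ∘ suc) (c′ ∘ suc) n))
          (distrib (s ℤ.^ suc n) (c 0) (c′ 0) y (eval (c ∘ suc) n) (eval (c′ ∘ suc) n))
    where
    distrib : ∀ p a b y u v → p * (a + b) + y * (u + v) ≡ (p * a + y * u) + (p * b + y * v)
    distrib = solve-∀

  -- The new top term vanishes, and in every other term the exponent of `s` grows by one.
  eval-extend : ∀ c n → c (suc n) ≡ 0ℤ → eval c (suc n) ≡ s * eval c n
  eval-extend c zero    c≡0 = trans (cong (λ u → s ℤ.^ 1 * c 0 + y * u) c≡0) (lem s (c 0) y)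
    where
    lem : ∀ s a y → s * 1ℤ * a + y * 0ℤ ≡ s * a
    lem = solve-∀
  eval-extend c (suc n) c≡0 =
    trans (cong (λ u → s ℤ.^ suc (suc n) * c 0 + y * u) (eval-extend (c ∘ suc) n c≡0))
          (lem s (s ℤ.^ suc n) (c 0) y (eval (c ∘ suc) n))
    where
    lem : ∀ s p a y u → s * p * a + y * (s * u) ≡ s * (p * a + y * u)
    lem = solve-∀

  B D : ℕ → ℤ
  B n = eval (λ k → + ((n ℕ.+ k) C (2 ℕ.* k))) n
  D n = eval (λ k → + ((suc n ℕ.+ k) C suc (2 ℕ.* k))) n

  2*[1+k] : ∀ k → 2 ℕ.* suc k ≡ suc (suc (2 ℕ.* k))
  2*[1+k] = ℕ.*-suc 2

  -- Pascal's rule splits C(n+1+k,2k) by the parity of the lower index. The even part is `B n`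
  -- extended by a zero term; the odd part, shifted by one in k, is `D n` with a factor `y` pulled
  -- out.
  B-suc : ∀ n → B (suc n) ≡ s * B n + y * D n
  B-suc n = begin
    B (suc n)                             ≡⟨ eval-cong pascal (suc n) ⟩
    eval (λ k → even k + odd k) (suc n)   ≡⟨ eval-+ even odd (suc n) ⟩
    eval even (suc n) + eval odd (suc n)  ≡⟨ cong₂ _+_ (eval-extend even n (cong +_ ([n+1+n]C[2+2n]≡0 n))) odd≡ ⟩
    s * B n + y * D n                     ∎
    where
    even odd : ℕ → ℤ
    even k = + ((n ℕ.+ k) C (2 ℕ.* k))
    -- Stands for a binomial with lower index -1, to which the library's form of Pascal's rule does
    -- not reach.
    odd zero    = 0ℤ
    odd (suc k) = + ((suc n ℕ.+ k) C suc (2 ℕ.* k))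
    pascal : ∀ k → + ((suc n ℕ.+ k) C (2 ℕ.* k)) ≡ even k + odd k
    pascal zero    = cong +_ (trans (nC0≡1 (suc n ℕ.+ 0)) (cong (ℕ._+ 0) (sym (nC0≡1 (n ℕ.+ 0)))))
    pascal (suc k) = cong +_ (begin
      (suc n ℕ.+ suc k) C (2 ℕ.* suc k)
        ≡⟨ cong ((suc n ℕ.+ suc k) C_) (2*[1+k] k) ⟩
      suc (n ℕ.+ suc k) C suc (suc (2 ℕ.* k))
        ≡⟨ nCk+nC[k+1]≡[n+1]C[k+1] (n ℕ.+ suc k) (suc (2 ℕ.* k)) ⟨
      (n ℕ.+ suc k) C suc (2 ℕ.* k) ℕ.+ (n ℕ.+ suc k) C suc (suc (2 ℕ.* k))
        ≡⟨ cong₂ (λ u v → u C suc (2 ℕ.* k) ℕ.+ (n ℕ.+ suc k) C v) (ℕ.+-suc n k) (sym (2*[1+k] k)) ⟩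
      (suc n ℕ.+ k) C suc (2 ℕ.* k) ℕ.+ (n ℕ.+ suc k) C (2 ℕ.* suc k)
        ≡⟨ ℕ.+-comm ((suc n ℕ.+ k) C suc (2 ℕ.* k)) _ ⟩
      (n ℕ.+ suc k) C (2 ℕ.* suc k) ℕ.+ (suc n ℕ.+ k) C suc (2 ℕ.* k) ∎)
    odd≡ : eval odd (suc n) ≡ y * D n
    odd≡ = trans (cong (_+ y * D n) (ℤ.*-zeroʳ (s ℤ.^ suc n))) (ℤ.+-identityˡ _)

  -- The same splitting one index higher. The even part is `B (suc n)` as it stands; the odd part is
  -- `D n` extended by C(2n+2,2n+3) = 0.
  D-suc : ∀ n → D (suc n) ≡ B (suc n) + s * D n
  D-suc n = begin
    D (suc n)
      ≡⟨ eval-cong (λ k → cong +_ (sym (nCk+nC[k+1]≡[n+1]C[k+1] (suc n ℕ.+ k) (2 ℕ.* k)))) (suc n) ⟩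
    eval (λ k → even k + odd k) (suc n)   ≡⟨ eval-+ even odd (suc n) ⟩
    B (suc n) + eval odd (suc n)          ≡⟨ cong (_+_ (B (suc n))) (eval-extend odd n top) ⟩
    B (suc n) + s * D n                   ∎
    where
    even odd : ℕ → ℤ
    even k = + ((suc n ℕ.+ k) C (2 ℕ.* k))
    odd k  = + ((suc n ℕ.+ k) C suc (2 ℕ.* k))
    top : odd (suc n) ≡ 0ℤ
    top = cong +_ (k>n⇒nCk≡0 (ℕ.≤-reflexive (lem n)))
      where lem : ∀ n → suc (suc n ℕ.+ suc n) ≡ suc (2 ℕ.* suc n)
            lem = ℕ.solve-∀

  eval-coeff : ∀ n → eval (λ k → + coeff n k) (suc n) ≡ B (suc n) + s * B n
  eval-coeff n = trans
    (eval-+ (λ k → + ((suc n ℕ.+ k) C (2 ℕ.* k))) even (suc n))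
    (cong (_+_ (B (suc n))) (eval-extend even n (cong +_ ([n+1+n]C[2+2n]≡0 n))))
    where
    even : ℕ → ℤ
    even k = + ((n ℕ.+ k) C (2 ℕ.* k))

  module _ (s²≡1 : s * s ≡ 1ℤ) where

    -- Elimination of `D`: by `B-suc`, the leftover term `s * (y * D n)` equals `s * B (suc n)`
    -- minus `s * s * B n`, and `s * s` is 1.
    B-rec : ∀ n → B (suc (suc n)) ≡ (y + + 2 * s) * B (suc n) + - B n
    B-rec n = begin
      B (suc (suc n))
        ≡⟨ B-suc (suc n) ⟩
      s * B (suc n) + y * D (suc n)
        ≡⟨ cong (λ u → s * B (suc n) + y * u) (D-suc n) ⟩
      s * B (suc n) + y * (B (suc n) + s * D n)
        ≡⟨ lem₁ s y (B (suc n)) (B n) (D n) ⟩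
      s * B (suc n) + y * B (suc n) + s * (s * B n + y * D n) + - (s * s * B n)
        ≡⟨ cong₂ (λ u v → s * B (suc n) + y * B (suc n) + s * u + - (v * B n)) (sym (B-suc n)) s²≡1 ⟩
      s * B (suc n) + y * B (suc n) + s * B (suc n) + - (1ℤ * B n)
        ≡⟨ lem₂ s y (B (suc n)) (B n) ⟩
      (y + + 2 * s) * B (suc n) + - B n ∎
      where
      lem₁ : ∀ s y b a d → s * b + y * (b + s * d) ≡ s * b + y * b + s * (s * a + y * d) + - (s * s * a)
      lem₁ = solve-∀
      lem₂ : ∀ s y b a → s * b + y * b + s * b + - (1ℤ * a) ≡ (y + + 2 * s) * b + - a
      lem₂ = solve-∀

    -- Both sides obey the same second-order recurrence. The left side starts at index 1, since `B`
    -- has no value at -1, so the base cases are the indices 1 and 2 and `ℓ 0` enters only through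
    -- `ℓ-rec 0`.
    B+sB≡ℓ : (ℓ : ℕ → ℤ) → ℓ 0 ≡ + 2 → ℓ 1 ≡ y + + 2 * s →
      (∀ n → ℓ (suc (suc n)) ≡ (y + + 2 * s) * ℓ (suc n) + - ℓ n) →
      ∀ n → B (suc n) + s * B n ≡ ℓ (suc n)
    B+sB≡ℓ ℓ ℓ₀ ℓ₁ ℓ-rec zero = trans (lem s y) (sym ℓ₁)
      where
      lem : ∀ s y → (s * 1ℤ * 1ℤ + y * 1ℤ) + s * 1ℤ ≡ y + + 2 * s
      lem = solve-∀
    B+sB≡ℓ ℓ ℓ₀ ℓ₁ ℓ-rec (suc zero) = begin
      B 2 + s * B 1                                   ≡⟨ cong (_+ s * B 1) (B-rec 0) ⟩
      -- With t = y + 2s one has `B 1` = t - s, so the left side is (t + s)(t - s) - 1, and 1 + s² =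
      -- 2 is `ℓ 0`.
      (y + + 2 * s) * B 1 + - 1ℤ + s * B 1            ≡⟨ lem₁ s y ⟩
      (y + + 2 * s) * (y + + 2 * s) + - (1ℤ + s * s)  ≡⟨ cong₂ (λ u v → (y + + 2 * s) * u + - v) (sym ℓ₁)
                                                          (trans (cong (_+_ 1ℤ) s²≡1) (sym ℓ₀)) ⟩
      (y + + 2 * s) * ℓ 1 + - ℓ 0                     ≡⟨ ℓ-rec 0 ⟨
      ℓ 2                                             ∎
      where
      lem₁ : ∀ s y → (y + + 2 * s) * (s * 1ℤ * 1ℤ + y * 1ℤ) + - 1ℤ + s * (s * 1ℤ * 1ℤ + y * 1ℤ)
                   ≡ (y + + 2 * s) * (y + + 2 * s) + - (1ℤ + s * s)
      lem₁ = solve-∀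
    B+sB≡ℓ ℓ ℓ₀ ℓ₁ ℓ-rec (suc (suc n)) = begin
      B (3 ℕ.+ n) + s * B (2 ℕ.+ n)
        ≡⟨ cong₂ (λ u v → u + s * v) (B-rec (suc n)) (B-rec n) ⟩
      (t * B (2 ℕ.+ n) + - B (suc n)) + s * (t * B (suc n) + - B n)
        ≡⟨ lem s t (B (2 ℕ.+ n)) (B (suc n)) (B n) ⟩
      t * (B (2 ℕ.+ n) + s * B (suc n)) + - (B (suc n) + s * B n)
        ≡⟨ cong₂ (λ u v → t * u + - v) (B+sB≡ℓ ℓ ℓ₀ ℓ₁ ℓ-rec (suc n)) (B+sB≡ℓ ℓ ℓ₀ ℓ₁ ℓ-rec n) ⟩
      t * ℓ (2 ℕ.+ n) + - ℓ (suc n)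
        ≡⟨ ℓ-rec (suc n) ⟨
      ℓ (3 ℕ.+ n) ∎
      where
      t = y + + 2 * s
      lem : ∀ s t c b a → (t * c + - b) + s * (t * b + - a) ≡ t * (c + s * b) + - (b + s * a)
      lem = solve-∀

-- Fibonacci and Lucas numbers

ε : ℕ → ℤ
ε n = -1ℤ ℤ.^ n

ε*ε≡1 : ∀ n → ε n ℤ.* ε n ≡ 1ℤ
ε*ε≡1 zero    = refl
ε*ε≡1 (suc n) = trans (lem (ε n)) (ε*ε≡1 n)
  where
  lem : ∀ e → -1ℤ ℤ.* e ℤ.* (-1ℤ ℤ.* e) ≡ e ℤ.* e
  lem = solve-∀

ε-even : ∀ n → ε (2 ℕ.* n) ≡ 1ℤ
ε-even n = begin
  ε (n ℕ.+ (n ℕ.+ 0)) ≡⟨ cong (λ k → ε (n ℕ.+ k)) (ℕ.+-identityʳ n) ⟩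
  ε (n ℕ.+ n)         ≡⟨ ℤ.^-distribˡ-+-* -1ℤ n n ⟩
  ε n ℤ.* ε n         ≡⟨ ε*ε≡1 n ⟩
  1ℤ                  ∎

module Sequences where

  open import Data.Integer.Base using (_+_; _*_; -_)

  f ℓ : ℕ → ℤ
  f n = + fib n
  ℓ n = + lucas n

  -- Chosen over F(n+1) + F(n-1) to avoid a predecessor. It turns each Lucas identity below into a
  -- polynomial identity in consecutive Fibonacci numbers.
  ℓ≡ : ∀ n → ℓ n ≡ + 2 * f (suc n) + - f n
  ℓ≡ zero          = refl
  ℓ≡ (suc zero)    = refl
  ℓ≡ (suc (suc n)) = trans (cong₂ _+_ (ℓ≡ (suc n)) (ℓ≡ n)) (lem (f (suc n)) (f n))
    where
    lem : ∀ b a → (+ 2 * (b + a) + - b) + (+ 2 * b + - a) ≡ + 2 * (b + a + b) + - (b + a)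
    lem = solve-∀

  -- The quadratic form b² - ab - a² changes sign under (a, b) ↦ (b, a + b).
  cassini : ∀ n → f (suc n) * f (suc n) + - (f n * f (suc n)) + - (f n * f n) ≡ ε n
  cassini zero    = refl
  cassini (suc n) = trans (lem (f (suc n)) (f n)) (cong (_*_ -1ℤ) (cassini n))
    where
    lem : ∀ b a → (b + a) * (b + a) + - (b * (b + a)) + - (b * b) ≡ -1ℤ * (b * b + - (a * b) + - (a * a))
    lem = solve-∀

  f-+ : ∀ m n → f (suc (m ℕ.+ n)) ≡ f (suc m) * f (suc n) + f m * f n
  f-+ zero          n = lem (f (suc n)) (f n)
    where
    lem : ∀ d c → d ≡ 1ℤ * d + 0ℤ * c
    lem = solve-∀
  f-+ (suc zero)    n = lem (f (suc n)) (f n)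
    where
    lem : ∀ d c → d + c ≡ 1ℤ * d + 1ℤ * c
    lem = solve-∀
  f-+ (suc (suc m)) n =
    trans (cong₂ _+_ (f-+ (suc m) n) (f-+ m n)) (lem (f (suc m)) (f m) (f (suc n)) (f n))
    where
    lem : ∀ b a d c → ((b + a) * d + b * c) + (b * d + a * c) ≡ (b + a + b) * d + (b + a) * c
    lem = solve-∀

  -- The addition formula one index lower, with F(m-1) written as F(m+1) - F(m) so that m = 0 is
  -- allowed.
  f-+′ : ∀ m n → f (m ℕ.+ n) ≡ f m * f (suc n) + f (suc m) * f n + - (f m * f n)
  f-+′ zero    n = lem (f (suc n)) (f n)
    where
    lem : ∀ d c → c ≡ 0ℤ * d + 1ℤ * c + - (0ℤ * c)
    lem = solve-∀
  f-+′ (suc m) n = trans (f-+ m n) (lem (f (suc m)) (f m) (f (suc n)) (f n))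
    where
    lem : ∀ b a d c → b * d + a * c ≡ b * d + (b + a) * c + - (b * c)
    lem = solve-∀

  ℓ-+ : ∀ m n → ℓ (m ℕ.+ n) ≡
    + 2 * (f (suc m) * f (suc n) + f m * f n) + - (f m * f (suc n) + f (suc m) * f n + - (f m * f n))
  ℓ-+ m n = trans (ℓ≡ (m ℕ.+ n)) (cong₂ (λ u v → + 2 * u + - v) (f-+ m n) (f-+′ m n))

  ℓ-double : ∀ m → ℓ (2 ℕ.* m) ≡
    + 2 * (f (suc m) * f (suc m) + f m * f m) + - (f m * f (suc m) + f (suc m) * f m + - (f m * f m))
  ℓ-double m = trans (cong (λ k → ℓ (m ℕ.+ k)) (ℕ.+-identityʳ m)) (ℓ-+ m m)

  -- In terms of a = F(m) and b = F(m+1), the two sides differ by a multiple of Cassini's form. The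
  -- shape is y + 2s with y = L(m)², s = -(-1)^m; `ℓ-double-f²` does the same for y = 5F(m)², s =
  -- (-1)^m.
  ℓ-double-ℓ² : ∀ m → ℓ (2 ℕ.* m) ≡ ℓ m * ℓ m + + 2 * (- ε m)
  ℓ-double-ℓ² m = begin
    ℓ (2 ℕ.* m)
      ≡⟨ ℓ-double m ⟩
    + 2 * (b * b + a * a) + - (a * b + b * a + - (a * a))
      ≡⟨ lem a b ⟩
    (+ 2 * b + - a) * (+ 2 * b + - a) + + 2 * (- (b * b + - (a * b) + - (a * a)))
      ≡⟨ cong₂ (λ u v → u * u + + 2 * (- v)) (sym (ℓ≡ m)) (cassini m) ⟩
    ℓ m * ℓ m + + 2 * (- ε m) ∎
    where
    a = f m
    b = f (suc m)
    lem : ∀ a b → + 2 * (b * b + a * a) + - (a * b + b * a + - (a * a))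
                ≡ (+ 2 * b + - a) * (+ 2 * b + - a) + + 2 * (- (b * b + - (a * b) + - (a * a)))
    lem = solve-∀

  ℓ-double-f² : ∀ m → ℓ (2 ℕ.* m) ≡ + 5 * (f m * f m) + + 2 * ε m
  ℓ-double-f² m = begin
    ℓ (2 ℕ.* m)
      ≡⟨ ℓ-double m ⟩
    + 2 * (b * b + a * a) + - (a * b + b * a + - (a * a))
      ≡⟨ lem a b ⟩
    + 5 * (a * a) + + 2 * (b * b + - (a * b) + - (a * a))
      ≡⟨ cong (λ v → + 5 * (a * a) + + 2 * v) (cassini m) ⟩
    + 5 * (a * a) + + 2 * ε m ∎
    where
    a = f m
    b = f (suc m)
    lem : ∀ a b → + 2 * (b * b + a * a) + - (a * b + b * a + - (a * a))
                ≡ + 5 * (a * a) + + 2 * (b * b + - (a * b) + - (a * a))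
    lem = solve-∀

  -- This is Cayley-Hamilton for the e-th power of the Fibonacci matrix, with trace `ℓ e` and
  -- determinant `ε e`. In the expansion the determinant appears as Cassini's form in `c` and `d`.
  ℓ-step : ∀ e m → ℓ (e ℕ.+ (e ℕ.+ m)) ≡ ℓ e * ℓ (e ℕ.+ m) + - (ε e * ℓ m)
  ℓ-step e m = begin
    ℓ (e ℕ.+ (e ℕ.+ m))
      ≡⟨ ℓ-+ e (e ℕ.+ m) ⟩
    + 2 * (d * f (suc (e ℕ.+ m)) + c * f (e ℕ.+ m))
      + - (c * f (suc (e ℕ.+ m)) + d * f (e ℕ.+ m) + - (c * f (e ℕ.+ m)))
      ≡⟨ cong₂ (λ z x → + 2 * (d * z + c * x) + - (c * z + d * x + - (c * x))) (f-+ e m) (f-+′ e m) ⟩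
    + 2 * (d * (d * b + c * a) + c * (c * b + d * a + - (c * a)))
      + - (c * (d * b + c * a) + d * (c * b + d * a + - (c * a)) + - (c * (c * b + d * a + - (c * a))))
      ≡⟨ lem a b c d ⟩
    (+ 2 * d + - c) * (+ 2 * (d * b + c * a) + - (c * b + d * a + - (c * a)))
      + - ((d * d + - (c * d) + - (c * c)) * (+ 2 * b + - a))
      ≡⟨ cong₂ (λ u v → u + - v) (cong₂ _*_ (sym (ℓ≡ e)) (sym (ℓ-+ e m)))
                                 (cong₂ _*_ (cassini e) (sym (ℓ≡ m))) ⟩
    ℓ e * ℓ (e ℕ.+ m) + - (ε e * ℓ m) ∎
    where
    a = f m
    b = f (suc m)
    c = f e
    d = f (suc e)
    lem : ∀ a b c d →
      + 2 * (d * (d * b + c * a) + c * (c * b + d * a + - (c * a)))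
        + - (c * (d * b + c * a) + d * (c * b + d * a + - (c * a)) + - (c * (c * b + d * a + - (c * a))))
      ≡ (+ 2 * d + - c) * (+ 2 * (d * b + c * a) + - (c * b + d * a + - (c * a)))
        + - ((d * d + - (c * d) + - (c * c)) * (+ 2 * b + - a))
    lem = solve-∀

  -- The stride `e` is even, so the sign in `ℓ-step` is 1.
  ℓ-multiples : ∀ m n → let e = 2 ℕ.* m in
    ℓ (e ℕ.* suc (suc n)) ≡ ℓ e * ℓ (e ℕ.* suc n) + - ℓ (e ℕ.* n)
  ℓ-multiples m n = begin
    ℓ (e ℕ.* suc (suc n))                          ≡⟨ cong ℓ (trans (ℕ.*-suc e (suc n)) (cong (e ℕ.+_) (ℕ.*-suc e n))) ⟩
    ℓ (e ℕ.+ (e ℕ.+ e ℕ.* n))                      ≡⟨ ℓ-step e (e ℕ.* n) ⟩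
    ℓ e * ℓ (e ℕ.+ e ℕ.* n) + - (ε e * ℓ (e ℕ.* n)) ≡⟨ cong₂ (λ k u → ℓ e * ℓ k + - (u * ℓ (e ℕ.* n))) (sym (ℕ.*-suc e n)) (ε-even m) ⟩
    ℓ e * ℓ (e ℕ.* suc n) + - (1ℤ * ℓ (e ℕ.* n))   ≡⟨ cong (λ u → ℓ e * ℓ (e ℕ.* suc n) + - u) (ℤ.*-identityˡ (ℓ (e ℕ.* n))) ⟩
    ℓ e * ℓ (e ℕ.* suc n) + - ℓ (e ℕ.* n)          ∎
    where e = 2 ℕ.* m

-- Negative indices and signs

-- The reflection sign squares to 1. Only squares of `L p` and `F p` enter the sums, so p may be
-- replaced by its absolute value.
L*L≡L∣∙∣*L∣∙∣ : ∀ z → L z ℤ.* L z ≡ L (+ ∣ z ∣) ℤ.* L (+ ∣ z ∣)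
L*L≡L∣∙∣*L∣∙∣ (+ n)    = refl
L*L≡L∣∙∣*L∣∙∣ -[1+ n ] = trans (lem (ε (suc n)) (+ lucas (suc n)))
                     (trans (cong (λ u → u ℤ.* (+ lucas (suc n) ℤ.* + lucas (suc n))) (ε*ε≡1 (suc n))) (ℤ.*-identityˡ _))
  where
  lem : ∀ e l → e ℤ.* l ℤ.* (e ℤ.* l) ≡ e ℤ.* e ℤ.* (l ℤ.* l)
  lem = solve-∀

F*F≡F∣∙∣*F∣∙∣ : ∀ z → F z ℤ.* F z ≡ F (+ ∣ z ∣) ℤ.* F (+ ∣ z ∣)
F*F≡F∣∙∣*F∣∙∣ (+ n)    = refl
F*F≡F∣∙∣*F∣∙∣ -[1+ n ] = trans (lem (ε n) (+ fib (suc n)))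
                     (trans (cong (λ u → u ℤ.* (+ fib (suc n) ℤ.* + fib (suc n))) (ε*ε≡1 n)) (ℤ.*-identityˡ _))
  where
  lem : ∀ e l → e ℤ.* l ℤ.* (e ℤ.* l) ≡ e ℤ.* e ℤ.* (l ℤ.* l)
  lem = solve-∀

L-even : ∀ z m → ∣ z ∣ ≡ 2 ℕ.* m → L z ≡ + lucas (2 ℕ.* m)
L-even (+ n)    m eq = cong (λ k → + lucas k) eq
L-even -[1+ n ] m eq =
  trans (cong (λ k → ε k ℤ.* + lucas k) eq)
        (trans (cong (ℤ._* + lucas (2 ℕ.* m)) (ε-even m)) (ℤ.*-identityˡ _))

L[2pn] : ∀ p n → L (+ 2 ℤ.* p ℤ.* + n) ≡ + lucas (2 ℕ.* ∣ p ∣ ℕ.* n)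
L[2pn] p n = trans (L-even (+ 2 ℤ.* p ℤ.* + n) (∣ p ∣ ℕ.* n) abs≡) (cong (λ k → + lucas k) (sym (ℕ.*-assoc 2 ∣ p ∣ n)))
  where
  abs≡ : ∣ + 2 ℤ.* p ℤ.* + n ∣ ≡ 2 ℕ.* (∣ p ∣ ℕ.* n)
  abs≡ = begin
    ∣ + 2 ℤ.* p ℤ.* + n ∣    ≡⟨ ℤ.abs-* (+ 2 ℤ.* p) (+ n) ⟩
    ∣ + 2 ℤ.* p ∣ ℕ.* n      ≡⟨ cong (ℕ._* n) (ℤ.abs-* (+ 2) p) ⟩
    2 ℕ.* ∣ p ∣ ℕ.* n        ≡⟨ ℕ.*-assoc 2 ∣ p ∣ n ⟩
    2 ℕ.* (∣ p ∣ ℕ.* n)      ∎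

-- Going from p to p - 1 moves the absolute value by one, down for positive p and up otherwise, so
-- its parity flips. Hence the first sum has s = -(-1)^p.
ε-pred : ∀ p → ε ∣ p ℤ.- + 1 ∣ ≡ ℤ.- ε ∣ p ∣
ε-pred (+ zero)    = refl
ε-pred (+ suc n)   = lem (ε n)
  where
  lem : ∀ e → e ≡ ℤ.- (-1ℤ ℤ.* e)
  lem = solve-∀
ε-pred -[1+ n ] rewrite ℕ.+-identityʳ n = lem (ε (suc n))
  where
  lem : ∀ e → -1ℤ ℤ.* e ≡ ℤ.- e
  lem = solve-∀

ε-* : ∀ p j → ε ∣ p ℤ.* + j ∣ ≡ ε ∣ p ∣ ℤ.^ j
ε-* p j = trans (cong ε (ℤ.abs-* p (+ j))) (sym (ℤ.^-*-assoc -1ℤ ∣ p ∣ j))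

-- Transfer to the rationals

open import Data.Rational.Base using (ℚ; _*_; _/_; -_; 1ℚ; ½; toℚᵘ)
import Data.Rational.Base as ℚ
open import Data.Rational.Properties using (+-0-monoid)
import Data.Rational.Properties as ℚ
open import Data.Rational.Literals using (fromℤ)
open import Data.Rational.Unnormalised.Base as ℚᵘ using (mkℚᵘ; *≡*)
import Data.Rational.Unnormalised.Properties as ℚᵘ
open import Algebra.Properties.Monoid.Sum +-0-monoid using (sum⁺-syntax; sum-cong-≗)
open import Algebra.Properties.Semiring.Sum
  (CommutativeRing.semiring ℚ.+-*-commutativeRing) using (*-distribˡ-sum)
open import Algebra.Properties.CommutativeSemiring.Exp
  (CommutativeRing.commutativeSemiring ℚ.+-*-commutativeRing) using (^-assocʳ; ^-distrib-*)

fromℤ-+ : ∀ i j → fromℤ (i ℤ.+ j) ≡ fromℤ i ℚ.+ fromℤ j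
fromℤ-+ i j = ℚ.toℚᵘ-injective
  (ℚᵘ.≃-trans (*≡* (lem i j)) (ℚᵘ.≃-sym (ℚ.toℚᵘ-homo-+ (fromℤ i) (fromℤ j))))
  where
  lem : ∀ i j → (i ℤ.+ j) ℤ.* + 1 ≡ (i ℤ.* + 1 ℤ.+ j ℤ.* + 1) ℤ.* + 1
  lem = solve-∀

fromℤ-* : ∀ i j → fromℤ (i ℤ.* j) ≡ fromℤ i * fromℤ j
fromℤ-* i j = ℚ.toℚᵘ-injective
  (ℚᵘ.≃-trans (*≡* refl) (ℚᵘ.≃-sym (ℚ.toℚᵘ-homo-* (fromℤ i) (fromℤ j))))

fromℤ-^ : ∀ i n → fromℤ (i ℤ.^ n) ≡ fromℤ i ^ n
fromℤ-^ i zero    = refl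
fromℤ-^ i (suc n) = trans (fromℤ-* i (i ℤ.^ n)) (cong (fromℤ i *_) (fromℤ-^ i n))

-- Cross-multiplication, carried out on unnormalised fractions, where no gcd blocks computation.
i/d*j≡k/e : ∀ i d j k e .{{_ : ℕ.NonZero d}} .{{_ : ℕ.NonZero e}} →
  i ℤ.* j ℤ.* + e ≡ k ℤ.* + d → i / d * fromℤ j ≡ k / e
i/d*j≡k/e i (suc d) j k (suc e) eq = ℚ.toℚᵘ-injective (begin′
  toℚᵘ (i / suc d * fromℤ j)                ≈⟨ ℚ.toℚᵘ-homo-* (i / suc d) (fromℤ j) ⟩
  toℚᵘ (i / suc d) ℚᵘ.* mkℚᵘ j 0            ≈⟨ ℚᵘ.*-congʳ (ℚ.toℚᵘ-fromℚᵘ (mkℚᵘ i d)) ⟩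
  mkℚᵘ i d ℚᵘ.* mkℚᵘ j 0                    ≈⟨ *≡* (trans eq (cong (λ m → k ℤ.* + m) (sym (ℕ.*-identityʳ (suc d))))) ⟩
  mkℚᵘ k e                                  ≈⟨ ℚ.toℚᵘ-fromℚᵘ (mkℚᵘ k e) ⟨
  toℚᵘ (k / suc e)                          ∎′)
  where
  open import Relation.Binary.Reasoning.Setoid ℚᵘ.≃-setoid
    using (step-≈-⟩; step-≈-⟨) renaming (begin_ to begin′_; _∎ to _∎′)

i/2≡½*i : ∀ i → i / 2 ≡ ½ * fromℤ i
i/2≡½*i i = sym (i/d*j≡k/e (+ 1) 2 i i 2 (cong (ℤ._* + 2) (ℤ.*-identityˡ i)))

-- The inverse of -1 computes to -1, so the sign of the exponent is immaterial.
-1^≡ε : ∀ z → (- 1ℚ) ^ᶻ z ≡ fromℤ (ε ∣ z ∣)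
-1^≡ε (+ n)    = sym (fromℤ-^ -1ℤ n)
-1^≡ε -[1+ n ] = sym (fromℤ-^ -1ℤ (suc n))

+n-+k≡+[n∸k] : ∀ {n k} → k ≤ n → + n ℤ.- + k ≡ + (n ∸ k)
+n-+k≡+[n∸k] {n} {k} k≤n = trans (ℤ.[+m]-[+n]≡m⊖n n k) (ℤ.⊖-≥ k≤n)

-1^[q*[n-k]] : ∀ q {n k} → k ≤ n → (- 1ℚ) ^ᶻ (q ℤ.* (+ n ℤ.- + k)) ≡ fromℤ (ε ∣ q ∣ ℤ.^ (n ∸ k))
-1^[q*[n-k]] q {n} {k} k≤n = begin
  (- 1ℚ) ^ᶻ (q ℤ.* (+ n ℤ.- + k)) ≡⟨ cong (λ j → (- 1ℚ) ^ᶻ (q ℤ.* j)) (+n-+k≡+[n∸k] k≤n) ⟩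
  (- 1ℚ) ^ᶻ (q ℤ.* + (n ∸ k))     ≡⟨ -1^≡ε (q ℤ.* + (n ∸ k)) ⟩
  fromℤ (ε ∣ q ℤ.* + (n ∸ k) ∣)   ≡⟨ cong fromℤ (ε-* q (n ∸ k)) ⟩
  fromℤ (ε ∣ q ∣ ℤ.^ (n ∸ k))     ∎

fromℤ^[2k] : ∀ i k → fromℤ i ^ (2 ℕ.* k) ≡ fromℤ (i ℤ.* i) ^ k
fromℤ^[2k] i k = trans (sym (^-assocʳ (fromℤ i) 2 k)) (cong (_^ k)
  (trans (cong (fromℤ i *_) (ℚ.*-identityʳ (fromℤ i))) (sym (fromℤ-* i i))))

-- The rational sums as values of `eval`

module _ (s y : ℤ) where

  open HomogeneousSum s y

  -- The sum is peeled at k = 0, as in the recursion of `eval`: every later term carries a factor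
  -- `y`.
  ∑≡eval : ∀ c n → ∑[ k ≤ n ] fromℤ (s ℤ.^ (n ∸ toℕ k) ℤ.* c (toℕ k) ℤ.* y ℤ.^ toℕ k) ≡ fromℤ (eval c n)
  ∑≡eval c zero    = trans (ℚ.+-identityʳ _) (cong fromℤ (lem (c 0)))
    where
    lem : ∀ a → 1ℤ ℤ.* a ℤ.* 1ℤ ≡ a
    lem = solve-∀
  ∑≡eval c (suc n) = begin
    fromℤ (p ℤ.* c 0 ℤ.* 1ℤ) ℚ.+ ∑[ k ≤ n ] fromℤ (s ℤ.^ (n ∸ toℕ k) ℤ.* c (suc (toℕ k)) ℤ.* (y ℤ.* y ℤ.^ toℕ k))
      ≡⟨ cong₂ ℚ._+_ (cong fromℤ (ℤ.*-identityʳ (p ℤ.* c 0))) (sum-cong-≗ pull) ⟩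
    fromℤ (p ℤ.* c 0) ℚ.+ ∑[ k ≤ n ] (fromℤ y * term k)
      ≡⟨ cong (fromℤ (p ℤ.* c 0) ℚ.+_) (*-distribˡ-sum (fromℤ y) term) ⟨
    fromℤ (p ℤ.* c 0) ℚ.+ fromℤ y * ∑[ k ≤ n ] term k
      ≡⟨ cong (λ u → fromℤ (p ℤ.* c 0) ℚ.+ fromℤ y * u) (∑≡eval (c ∘ suc) n) ⟩
    fromℤ (p ℤ.* c 0) ℚ.+ fromℤ y * fromℤ (eval (c ∘ suc) n)
      ≡⟨ cong (fromℤ (p ℤ.* c 0) ℚ.+_) (fromℤ-* y (eval (c ∘ suc) n)) ⟨
    fromℤ (p ℤ.* c 0) ℚ.+ fromℤ (y ℤ.* eval (c ∘ suc) n)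
      ≡⟨ fromℤ-+ (p ℤ.* c 0) (y ℤ.* eval (c ∘ suc) n) ⟨
    fromℤ (eval c (suc n)) ∎
    where
    p = s ℤ.^ suc n
    term : Fin (suc n) → ℚ
    term k = fromℤ (s ℤ.^ (n ∸ toℕ k) ℤ.* c (suc (toℕ k)) ℤ.* y ℤ.^ toℕ k)
    lem : ∀ a b y q → a ℤ.* b ℤ.* (y ℤ.* q) ≡ y ℤ.* (a ℤ.* b ℤ.* q)
    lem = solve-∀
    pull : ∀ k → fromℤ (s ℤ.^ (n ∸ toℕ k) ℤ.* c (suc (toℕ k)) ℤ.* (y ℤ.* y ℤ.^ toℕ k)) ≡ fromℤ y * term k
    pull k = trans (cong fromℤ (lem (s ℤ.^ (n ∸ toℕ k)) (c (suc (toℕ k))) y (y ℤ.^ toℕ k)))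
                   (fromℤ-* y _)

  -- `σ` and `π` stay abstract because the two sums write the sign and the power of `y` differently.
  summand : ∀ m k → k ≤ suc m → ∀ {σ π} → σ ≡ fromℤ (s ℤ.^ (suc m ∸ k)) → π ≡ fromℤ y ^ k →
    σ * (+ suc m / (suc m ℕ.+ k)) * fromℤ (+ ((suc m ℕ.+ k) C (suc m ∸ k))) * π
      ≡ ½ * fromℤ (s ℤ.^ (suc m ∸ k) ℤ.* + coeff m k ℤ.* y ℤ.^ k)
  summand m k k≤n {σ} {π} σ≡ π≡ = begin
    σ * (+ n / (n ℕ.+ k)) * fromℤ (+ c) * π
      ≡⟨ cong (_* π) (ℚ.*-assoc σ (+ n / (n ℕ.+ k)) (fromℤ (+ c))) ⟩
    σ * (+ n / (n ℕ.+ k) * fromℤ (+ c)) * π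
      -- The fraction times the binomial is half the integer `a`; this is the source of the 1/2 in
      -- the result.
      ≡⟨ cong (λ u → σ * u * π) (trans (i/d*j≡k/e (+ n) (n ℕ.+ k) (+ c) (+ a) 2 n*c*2≡) (i/2≡½*i (+ a))) ⟩
    σ * (½ * fromℤ (+ a)) * π
      ≡⟨ cong (_* π) (x∙yz≈y∙xz σ ½ (fromℤ (+ a))) ⟩
    ½ * (σ * fromℤ (+ a)) * π
      ≡⟨ ℚ.*-assoc ½ (σ * fromℤ (+ a)) π ⟩
    ½ * (σ * fromℤ (+ a) * π)
      ≡⟨ cong₂ (λ u v → ½ * (u * fromℤ (+ a) * v)) σ≡ (trans π≡ (sym (fromℤ-^ y k))) ⟩
    ½ * (fromℤ S * fromℤ (+ a) * fromℤ (y ℤ.^ k))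
      ≡⟨ cong (λ u → ½ * (u * fromℤ (y ℤ.^ k))) (fromℤ-* S (+ a)) ⟨
    ½ * (fromℤ (S ℤ.* + a) * fromℤ (y ℤ.^ k))
      ≡⟨ cong (½ *_) (fromℤ-* (S ℤ.* + a) (y ℤ.^ k)) ⟨
    ½ * fromℤ (S ℤ.* + a ℤ.* y ℤ.^ k) ∎
    where
    open import Algebra.Properties.CommutativeSemigroup
      (CommutativeRing.*-commutativeSemigroup ℚ.+-*-commutativeRing) using (x∙yz≈y∙xz)
    n = suc m
    c = (n ℕ.+ k) C (n ∸ k)
    a = coeff m k
    S = s ℤ.^ (n ∸ k)
    lem : ∀ n c → n ℕ.* c ℕ.* 2 ≡ 2 ℕ.* n ℕ.* c
    lem = ℕ.solve-∀
    n*c*2≡ : + n ℤ.* + c ℤ.* + 2 ≡ + a ℤ.* + (n ℕ.+ k)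
    n*c*2≡ = begin
      + n ℤ.* + c ℤ.* + 2    ≡⟨ cong (ℤ._* + 2) (ℤ.pos-* n c) ⟨
      + (n ℕ.* c) ℤ.* + 2    ≡⟨ ℤ.pos-* (n ℕ.* c) 2 ⟨
      + (n ℕ.* c ℕ.* 2)      ≡⟨ cong +_ (trans (lem n c) (trans (2n*[n+k]C[n-k]≡coeff m k k≤n) (ℕ.*-comm (n ℕ.+ k) a))) ⟩
      + (a ℕ.* (n ℕ.+ k))    ≡⟨ ℤ.pos-* a (n ℕ.+ k) ⟩
      + a ℤ.* + (n ℕ.+ k)    ∎

  -- The common end of both identities. The hypothesis on `lucas (2 ℕ.* ∣ p ∣)` supplies both the
  -- value at index 1 and the coefficient of the recurrence for `ℓₙ`.
  ∑≡lucas/2 : s ℤ.* s ≡ 1ℤ → ∀ p → + lucas (2 ℕ.* ∣ p ∣) ≡ y ℤ.+ + 2 ℤ.* s →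
    ∀ m (t : Fin (suc (suc m)) → ℚ) →
    (∀ k → t k ≡ ½ * fromℤ (s ℤ.^ (suc m ∸ toℕ k) ℤ.* + coeff m (toℕ k) ℤ.* y ℤ.^ toℕ k)) →
    ∑[ k ≤ suc m ] t k ≡ L (+ 2 ℤ.* p ℤ.* + suc m) / 2
  ∑≡lucas/2 s²≡1 p trace m t t≡ = begin
    ∑[ k ≤ suc m ] t k
      ≡⟨ sum-cong-≗ t≡ ⟩
    ∑[ k ≤ suc m ] (½ * t′ k)
      ≡⟨ *-distribˡ-sum ½ t′ ⟨
    ½ * ∑[ k ≤ suc m ] t′ k
      ≡⟨ cong (½ *_) (∑≡eval (λ k → + coeff m k) (suc m)) ⟩
    ½ * fromℤ (eval (λ k → + coeff m k) (suc m))
      ≡⟨ cong (λ u → ½ * fromℤ u) (trans (eval-coeff m) (B+sB≡ℓ s²≡1 ℓₙ ℓ₀ ℓ₁ ℓ-rec m)) ⟩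
    ½ * fromℤ (ℓₙ (suc m))
      ≡⟨ i/2≡½*i (ℓₙ (suc m)) ⟨
    ℓₙ (suc m) / 2
      ≡⟨ cong (_/ 2) (L[2pn] p (suc m)) ⟨
    L (+ 2 ℤ.* p ℤ.* + suc m) / 2 ∎
    where
    t′ : Fin (suc (suc m)) → ℚ
    t′ k = fromℤ (s ℤ.^ (suc m ∸ toℕ k) ℤ.* + coeff m (toℕ k) ℤ.* y ℤ.^ toℕ k)
    e = 2 ℕ.* ∣ p ∣
    ℓₙ : ℕ → ℤ
    ℓₙ n = + lucas (e ℕ.* n)
    ℓ₀ : ℓₙ 0 ≡ + 2
    ℓ₀ = cong (λ k → + lucas k) (ℕ.*-zeroʳ e)
    ℓ₁ : ℓₙ 1 ≡ y ℤ.+ + 2 ℤ.* s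
    ℓ₁ = trans (cong (λ k → + lucas k) (ℕ.*-identityʳ e)) trace
    ℓ-rec : ∀ n → ℓₙ (suc (suc n)) ≡ (y ℤ.+ + 2 ℤ.* s) ℤ.* ℓₙ (suc n) ℤ.+ ℤ.- ℓₙ n
    ℓ-rec n = trans (Sequences.ℓ-multiples ∣ p ∣ n) (cong (λ u → u ℤ.* ℓₙ (suc n) ℤ.+ ℤ.- ℓₙ n) trace)

theorem3 : (n : ℕ) .{{_ : ℕ.NonZero n}} (p : ℤ) →
    (∑[ k ≤ n ] ((- 1ℚ) ^ᶻ ((p ℤ.- + 1) ℤ.* (+ n ℤ.- + toℕ k))
                 * (+ n / (n ℕ.+ toℕ k)) {{+-nonZeroˡ n (toℕ k)}}
                 * fromℤ (+ ((n ℕ.+ toℕ k) C (n ∸ toℕ k)))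
                 * fromℤ (L p) ^ (2 ℕ.* toℕ k))
      ≡ L (+ 2 ℤ.* p ℤ.* + n) / 2)
    ×
    (∑[ k ≤ n ] ((- 1ℚ) ^ᶻ (p ℤ.* (+ n ℤ.- + toℕ k))
                 * (+ n / (n ℕ.+ toℕ k)) {{+-nonZeroˡ n (toℕ k)}}
                 * fromℤ (+ ((n ℕ.+ toℕ k) C (n ∸ toℕ k)))
                 * fromℤ (+ 5) ^ toℕ k
                 * fromℤ (F p) ^ (2 ℕ.* toℕ k))
      ≡ L (+ 2 ℤ.* p ℤ.* + n) / 2)
theorem3 n@(suc m) p =
  ∑≡lucas/2 s y s²≡1 p trace m _
    (λ k → summand s y m (toℕ k) (toℕ≤pred[n] k)
      (trans (-1^[q*[n-k]] (p ℤ.- + 1) (toℕ≤pred[n] k))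
             (cong (λ u → fromℤ (u ℤ.^ (n ∸ toℕ k))) (ε-pred p)))
      (fromℤ^[2k] (L p) (toℕ k))) ,
  ∑≡lucas/2 s′ y′ (ε*ε≡1 ∣ p ∣) p trace′ m _
    -- The powers of 5 and of `F p` are separate factors of the summand; reassociation joins them
    -- into one power of `y′`.
    (λ k → trans
      (ℚ.*-assoc (σ k * (+ n / (n ℕ.+ toℕ k)) * fromℤ (+ ((n ℕ.+ toℕ k) C (n ∸ toℕ k))))
        (fromℤ (+ 5) ^ toℕ k) (fromℤ (F p) ^ (2 ℕ.* toℕ k)))
      (summand s′ y′ m (toℕ k) (toℕ≤pred[n] k)
        (-1^[q*[n-k]] p (toℕ≤pred[n] k)) (5^k*F^[2k] (toℕ k))))
  where
  s y s′ y′ : ℤ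
  s  = ℤ.- ε ∣ p ∣
  y  = L p ℤ.* L p
  s′ = ε ∣ p ∣
  y′ = + 5 ℤ.* (F p ℤ.* F p)
  σ : Fin (suc n) → ℚ
  σ k = (- 1ℚ) ^ᶻ (p ℤ.* (+ n ℤ.- + toℕ k))
  s²≡1 : s ℤ.* s ≡ 1ℤ
  s²≡1 = trans (lem (ε ∣ p ∣)) (ε*ε≡1 ∣ p ∣)
    where
    lem : ∀ e → ℤ.- e ℤ.* ℤ.- e ≡ e ℤ.* e
    lem = solve-∀
  trace : + lucas (2 ℕ.* ∣ p ∣) ≡ y ℤ.+ + 2 ℤ.* s
  trace = trans (Sequences.ℓ-double-ℓ² ∣ p ∣) (cong (ℤ._+ + 2 ℤ.* s) (sym (L*L≡L∣∙∣*L∣∙∣ p)))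
  trace′ : + lucas (2 ℕ.* ∣ p ∣) ≡ y′ ℤ.+ + 2 ℤ.* s′
  trace′ = trans (Sequences.ℓ-double-f² ∣ p ∣) (cong (λ u → + 5 ℤ.* u ℤ.+ + 2 ℤ.* s′) (sym (F*F≡F∣∙∣*F∣∙∣ p)))
  5^k*F^[2k] : ∀ k → fromℤ (+ 5) ^ k * fromℤ (F p) ^ (2 ℕ.* k) ≡ fromℤ y′ ^ k
  5^k*F^[2k] k = begin
    fromℤ (+ 5) ^ k * fromℤ (F p) ^ (2 ℕ.* k)     ≡⟨ cong (fromℤ (+ 5) ^ k *_) (fromℤ^[2k] (F p) k) ⟩
    fromℤ (+ 5) ^ k * fromℤ (F p ℤ.* F p) ^ k     ≡⟨ ^-distrib-* (fromℤ (+ 5)) (fromℤ (F p ℤ.* F p)) k ⟨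
    (fromℤ (+ 5) * fromℤ (F p ℤ.* F p)) ^ k       ≡⟨ cong (_^ k) (fromℤ-* (+ 5) (F p ℤ.* F p)) ⟨
    fromℤ y′ ^ k                                  ∎
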